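{- Let $D$ be a $7$-anti-transitive oriented graph on $n$ vertices. If the minimum out-degree and the minimum in-degree of $D$ are both at least $\frac{n}{3}$, then $D$ has a directed triangle, i.e. there are vertices $x,y,z$ of $D$ with $(x,y),(y,z),(z,x)\in E(D)$.
   Context: A digraph $D=(V,E)$ has a non-empty vertex set $V=V(D)$ and arc set $E=E(D)\subseteq V\times V$. An oriented graph is a finite digraph with no loops ($(u,u)\notin E$) and with at most one arc between any two vertices (so $(u,v)$ and $(v,u)$ are never both in $E$). The out-degree (in-degree) of a vertex $v$ is the number of vertices $u$ with $(v,u)\in E$ (respectively $(u,v)\in E$). Directed paths have pairwise distinct vertices, and the length of a directed path is its number of arcs. A digraph $D$ is $k$-anti-transitive if for every pair of vertices $u,v\in V(D)$, the existence of a directed path of length $k$ from $u$ to $v$ implies $(u,v)\notin E(D)$. -}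

module Defs where

open import Data.Fin.Base using (Fin; zero; suc; inject₁; fromℕ)
open import Data.Fin.Subset using (Subset; ∣_∣)
open import Data.Nat.Base using (ℕ; suc; _⊓_; NonZero)
open import Data.Product.Base using (_×_; ∃-syntax)
open import Data.Vec.Base using (tabulate; foldr₁)
open import Function.Definitions using (Injective)
open import Relation.Binary.Core using (Rel)
open import Relation.Binary.Definitions using (Asymmetric; Decidable; Irreflexive)
open import Relation.Binary.PropositionalEquality.Core using (_≡_)
open import Relation.Nullary.Decidable.Core using (does)
open import Relation.Nullary.Negation.Core using (¬_)
import Level

-- Finite digraphs on n ≥ 1 vertices; the vertex set is taken to be Fin n.
-- Decidability of the arc relation is what makes it an honest subset of V × V
-- constructively, so that degrees can be counted.
record Digraph (n : ℕ) : Set₁ where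
  field
    {{nonEmpty}} : NonZero n
    E            : Rel (Fin n) Level.zero
    E?           : Decidable E

  outNeighbours : Fin n → Subset n
  outNeighbours v = tabulate λ u → does (E? v u)

  inNeighbours : Fin n → Subset n
  inNeighbours v = tabulate λ u → does (E? u v)

  outDegree : Fin n → ℕ
  outDegree v = ∣ outNeighbours v ∣

  inDegree : Fin n → ℕ
  inDegree v = ∣ inNeighbours v ∣

minimum : ∀ {n} .{{_ : NonZero n}} → (Fin n → ℕ) → ℕ
minimum {suc n} f = foldr₁ _⊓_ (tabulate f)

module _ {n : ℕ} (D : Digraph n) where
  open Digraph D

  minOutDegree : ℕ
  minOutDegree = minimum outDegree

  minInDegree : ℕ
  minInDegree = minimum inDegree

  record IsOriented : Set where
    field
      loopless     : Irreflexive _≡_ E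
      atMostOneArc : Asymmetric E

  record DirectedPath (k : ℕ) (u v : Fin n) : Set where
    field
      vertex   : Fin (suc k) → Fin n
      distinct : Injective _≡_ _≡_ vertex
      arc      : ∀ (i : Fin k) → E (vertex (inject₁ i)) (vertex (suc i))
      start    : vertex zero ≡ u
      end      : vertex (fromℕ k) ≡ v

  AntiTransitive : ℕ → Set
  AntiTransitive k = ∀ (u v : Fin n) → DirectedPath k u v → ¬ E u v

  HasDirectedTriangle : Set
  HasDirectedTriangle = ∃[ x ] ∃[ y ] ∃[ z ] (E x y × E y z × E z x)

{-# OPTIONS --safe #-}

-- Suppose there is no directed triangle.  Counting the disjoint sets {v},
-- N⁻(v) and N⁺(v) ∪ N⁺(x) for an arc v → x shows that N⁺(v) ∩ N⁺(x) is never
-- empty, and that if it is a singleton then these sets cover all vertices.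
-- By the first part a walk inside N⁺(v) can always be continued.
--
-- If x₁ → ⋯ → x₅ were a path inside N⁺(v), the same fact for N⁻(x₅) would give
-- u → t → v with t, u ∈ N⁻(x₅), and u → t → v → x₁ → ⋯ → x₅ would be a path of
-- length 7 parallel to the arc u → x₅.  So every walk of four arcs inside N⁺(v)
-- closes up, and each of its vertices has just one out-neighbour in N⁺(v).
-- Now take x₁ → x₂ inside N⁺(v) and a walk x₂ → c₁ → c₂ → c₃ → x₂ inside N⁺(x₁).
-- By the covering statement for the arc v → x₂, the vertex c₃ lies in one of
-- {v}, N⁻(v), N⁺(v), N⁺(x₂), and each of these is absurd.
module Submission where

open import Defs
open import Data.Empty using (⊥)
open import Data.Fin.Base using (Fin; zero; suc)
open import Data.Fin.Patterns using (0F; 1F; 2F; 3F; 4F; 5F; 6F)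
open import Data.Fin.Properties using (any?; _≟_)
open import Data.Fin.Subset
  using (Subset; ∣_∣; _∈_; _∉_; _∩_; _∪_; ⁅_⁆; Empty; inside; outside)
open import Data.Fin.Subset.Properties
import Data.Integer.Base as ℤ
import Data.Integer.Properties as ℤ
open import Data.Nat.Base as ℕ using (ℕ; suc; _+_; _*_; _⊓_; NonZero)
open import Data.Nat.Properties as ℕ using (module ≤-Reasoning)
open import Data.Nat.Tactic.RingSolver using (solve-∀)
open import Data.Product.Base using (_×_; _,_; ∃-syntax)
open import Data.Rational.Base using (_/_; _≤_)
import Data.Rational.Properties as ℚ
import Data.Rational.Unnormalised.Base as ℚᵘ
import Data.Rational.Unnormalised.Properties as ℚᵘ
open import Data.Sum.Base using (inj₁; inj₂)
open import Data.Vec.Base using (Vec; []; _∷_; foldr₁; lookup; tabulate)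
open import Data.Vec.Properties using ([]=⇒lookup; lookup∘tabulate)
open import Data.Vec.Relation.Unary.All using ([]; _∷_)
open import Data.Vec.Relation.Unary.AllPairs using ([]; _∷_)
open import Data.Vec.Relation.Unary.Unique.Propositional using (Unique)
open import Data.Vec.Relation.Unary.Unique.Propositional.Properties
  using (lookup-injective)
open import Function.Base using (_∘_)
open import Level using (0ℓ)
open import Relation.Binary.PropositionalEquality
  using (_≡_; _≢_; refl; sym; trans; cong; cong₂; subst; module ≡-Reasoning)
open import Relation.Nullary.Decidable
  using (Dec; does; decidable-stable; yes; no; _×-dec_)
open import Relation.Nullary.Negation using (¬_; contradiction)
open import Relation.Unary using (Pred)

private
  variable
    n : ℕ

-- Cardinalities of unions of finite subsets.

∣p∪q∣+∣p∩q∣≡∣p∣+∣q∣ : (p q : Subset n) → ∣ p ∪ q ∣ + ∣ p ∩ q ∣ ≡ ∣ p ∣ + ∣ q ∣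
∣p∪q∣+∣p∩q∣≡∣p∣+∣q∣ []            []            = refl
∣p∪q∣+∣p∩q∣≡∣p∣+∣q∣ (inside ∷ p)  (inside ∷ q)  = cong suc
  (trans (ℕ.+-suc _ _) (trans (cong suc (∣p∪q∣+∣p∩q∣≡∣p∣+∣q∣ p q)) (sym (ℕ.+-suc _ _))))
∣p∪q∣+∣p∩q∣≡∣p∣+∣q∣ (inside ∷ p)  (outside ∷ q) = cong suc (∣p∪q∣+∣p∩q∣≡∣p∣+∣q∣ p q)
∣p∪q∣+∣p∩q∣≡∣p∣+∣q∣ (outside ∷ p) (inside ∷ q)  =
  trans (cong suc (∣p∪q∣+∣p∩q∣≡∣p∣+∣q∣ p q)) (sym (ℕ.+-suc _ _))
∣p∪q∣+∣p∩q∣≡∣p∣+∣q∣ (outside ∷ p) (outside ∷ q) = ∣p∪q∣+∣p∩q∣≡∣p∣+∣q∣ p q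

Empty⇒∣p∣≡0 : (p : Subset n) → Empty p → ∣ p ∣ ≡ 0
Empty⇒∣p∣≡0 {n} p p-empty = trans (cong ∣_∣ (Empty-unique p-empty)) (∣⊥∣≡0 n)

disjoint⇒∣p∪q∣≡∣p∣+∣q∣ : (p q : Subset n) → (∀ {x} → x ∈ p → x ∉ q) →
                         ∣ p ∪ q ∣ ≡ ∣ p ∣ + ∣ q ∣
disjoint⇒∣p∪q∣≡∣p∣+∣q∣ p q disjoint = begin
  ∣ p ∪ q ∣              ≡⟨ ℕ.+-identityʳ _ ⟨
  ∣ p ∪ q ∣ + 0          ≡⟨ cong (∣ p ∪ q ∣ ℕ.+_) (Empty⇒∣p∣≡0 (p ∩ q) p∩q-empty) ⟨
  ∣ p ∪ q ∣ + ∣ p ∩ q ∣  ≡⟨ ∣p∪q∣+∣p∩q∣≡∣p∣+∣q∣ p q ⟩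
  ∣ p ∣ + ∣ q ∣          ∎
  where
  open ≡-Reasoning
  p∩q-empty : Empty (p ∩ q)
  p∩q-empty (x , x∈p∩q) with x∈p , x∈q ← x∈p∩q⁻ p q x∈p∩q = disjoint x∈p x∈q

module _ {P : Pred (Fin n) 0ℓ} (P? : ∀ x → Dec (P x)) where

  ∈-tabulate⁻ : ∀ {x} → x ∈ tabulate (does ∘ P?) → P x
  ∈-tabulate⁻ {x} x∈ with P? x | trans (sym (lookup∘tabulate (does ∘ P?) x)) ([]=⇒lookup x∈)
  ... | yes Px | _  = Px
  ... | no  _  | ()

minimum≤ : ∀ .{{_ : NonZero n}} (f : Fin n → ℕ) x → minimum f ℕ.≤ f x
minimum≤ {suc n} f x = foldr₁-⊓≤ f x
  where
  foldr₁-⊓≤ : ∀ {m} (g : Fin (suc m) → ℕ) x → foldr₁ _⊓_ (tabulate g) ℕ.≤ g x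
  foldr₁-⊓≤ {0}     g zero    = ℕ.≤-refl
  foldr₁-⊓≤ {suc m} g zero    = ℕ.m⊓n≤m _ _
  foldr₁-⊓≤ {suc m} g (suc x) = ℕ.≤-trans (ℕ.m⊓n≤n _ _) (foldr₁-⊓≤ (g ∘ suc) x)

n/3≤d⇒n≤3d : ∀ n d → (ℤ.+ n) / 3 ≤ (ℤ.+ d) / 1 → n ℕ.≤ 3 * d
n/3≤d⇒n≤3d n d n/3≤d = subst (n ℕ.≤_) (ℕ.*-comm d 3) (ℤ.drop‿+≤+ (begin
  ℤ.+ n            ≡⟨ ℤ.*-identityʳ (ℤ.+ n) ⟨
  ℤ.+ n ℤ.* ℤ.+ 1    ≤⟨ ℚᵘ.drop-*≤* unnormalised ⟩
  ℤ.+ d ℤ.* ℤ.+ 3    ≡⟨ ℤ.pos-* d 3 ⟨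
  ℤ.+ (d * 3)      ∎))
  where
  open ℤ.≤-Reasoning
  -- `_/_` cancels common factors, so the comparison passes to unnormalised fractions, which store
  -- the denominator minus one: `2` stands for 3 and `0` for 1.
  unnormalised : ℚᵘ.mkℚᵘ (ℤ.+ n) 2 ℚᵘ.≤ ℚᵘ.mkℚᵘ (ℤ.+ d) 0
  unnormalised = ℚᵘ.≤-respˡ-≃ (ℚ.toℚᵘ-fromℚᵘ (ℚᵘ.mkℚᵘ (ℤ.+ n) 2))
    (ℚᵘ.≤-respʳ-≃ (ℚ.toℚᵘ-fromℚᵘ (ℚᵘ.mkℚᵘ (ℤ.+ d) 0)) (ℚ.toℚᵘ-mono-≤ n/3≤d))

-- Dense triangle-free oriented graphs and their reversal.

record DenseTriangleFree (D : Digraph n) : Set where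
  open Digraph D
  field
    oriented     : IsOriented D
    triangleFree : ¬ HasDirectedTriangle D
    outDense     : ∀ v → n ℕ.≤ 3 * outDegree v
    inDense      : ∀ v → n ℕ.≤ 3 * inDegree v
  open IsOriented oriented public

reverse : Digraph n → Digraph n
reverse D = record { E = λ u v → E v u ; E? = λ u v → E? v u }
  where open Digraph D

-- Reversal swaps the two degree bounds and reads triangles backwards, so every fact on
-- out-neighbourhoods has a twin for in-neighbourhoods.
reverse-dense : {D : Digraph n} → DenseTriangleFree D → DenseTriangleFree (reverse D)
reverse-dense H = record
  { oriented     = record
    { loopless     = loopless ∘ sym
    ; atMostOneArc = λ uv vu → atMostOneArc uv vu }
  ; triangleFree = λ (x , y , z , yx , zy , xz) → triangleFree (x , z , y , xz , zy , yx)
  ; outDense     = inDense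
  ; inDense      = outDense
  }
  where open DenseTriangleFree H

-- Counting around an arc `v → x`.

module OutNeighbourhoods {D : Digraph n} (H : DenseTriangleFree D) where
  open Digraph D
  open DenseTriangleFree H

  commonOutNeighbours : Fin n → Fin n → Subset n
  commonOutNeighbours v x = outNeighbours v ∩ outNeighbours x

  reached : Fin n → Fin n → Subset n
  reached v x = ⁅ v ⁆ ∪ (inNeighbours v ∪ (outNeighbours v ∪ outNeighbours x))

  module _ {v x : Fin n} (vx : E v x) where

    -- A vertex of N⁻(v) ∩ N⁺(x) would close a triangle through `v → x`; the other overlaps to
    -- exclude amount to loops or opposite arcs.
    ∣reached∣ : ∣ reached v x ∣ ≡
      1 + (inDegree v + ∣ outNeighbours v ∪ outNeighbours x ∣)
    ∣reached∣ = trans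
      (disjoint⇒∣p∪q∣≡∣p∣+∣q∣ ⁅ v ⁆ _ v-apart)
      (cong₂ _+_ (∣⁅x⁆∣≡1 v) (disjoint⇒∣p∪q∣≡∣p∣+∣q∣ (inNeighbours v) _ in-apart))
      where
      in-apart : ∀ {w} → w ∈ inNeighbours v → w ∉ outNeighbours v ∪ outNeighbours x
      in-apart {w} w∈in w∈out
        with wv ← ∈-tabulate⁻ (λ u → E? u v) w∈in
        with x∈p∪q⁻ (outNeighbours v) (outNeighbours x) w∈out
      ... | inj₁ w∈ = atMostOneArc wv (∈-tabulate⁻ (E? v) w∈)
      ... | inj₂ w∈ = triangleFree (v , x , w , vx , ∈-tabulate⁻ (E? x) w∈ , wv)

      v-apart : ∀ {w} → w ∈ ⁅ v ⁆ → w ∉ inNeighbours v ∪ (outNeighbours v ∪ outNeighbours x)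
      v-apart w∈v w∈ with refl ← x∈⁅y⁆⇒x≡y v w∈v
        with x∈p∪q⁻ (inNeighbours v) _ w∈
      ... | inj₁ v∈in = loopless refl (∈-tabulate⁻ (λ u → E? u v) v∈in)
      ... | inj₂ v∈out with x∈p∪q⁻ (outNeighbours v) (outNeighbours x) v∈out
      ... | inj₁ v∈ = loopless refl (∈-tabulate⁻ (E? v) v∈)
      ... | inj₂ v∈ = atMostOneArc vx (∈-tabulate⁻ (E? x) v∈)

    -- By inclusion-exclusion the two terms add up to three degrees, hence to at least `n`, plus one
    -- for `v` itself, which makes the bound strict.
    n<∣reached∣+∣common∣ : n ℕ.< ∣ reached v x ∣ + ∣ commonOutNeighbours v x ∣
    n<∣reached∣+∣common∣ = begin-strict
      n                                          ≤⟨ n≤a+b+c ⟩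
      inDegree v + (outDegree v + outDegree x)   ≡⟨ cong (inDegree v ℕ.+_)
        (∣p∪q∣+∣p∩q∣≡∣p∣+∣q∣ (outNeighbours v) (outNeighbours x)) ⟨
      inDegree v + (∪-size + ∩-size)             <⟨ ℕ.n<1+n _ ⟩
      1 + (inDegree v + (∪-size + ∩-size))       ≡⟨ cong suc (ℕ.+-assoc (inDegree v) _ _) ⟨
      1 + (inDegree v + ∪-size) + ∩-size         ≡⟨ cong (ℕ._+ ∩-size) ∣reached∣ ⟨
      ∣ reached v x ∣ + ∩-size                   ∎
      where
      open ≤-Reasoning
      ∪-size ∩-size : ℕ
      ∪-size = ∣ outNeighbours v ∪ outNeighbours x ∣
      ∩-size = ∣ commonOutNeighbours v x ∣

      n≤a+b+c : n ℕ.≤ inDegree v + (outDegree v + outDegree x)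
      n≤a+b+c = ℕ.*-cancelˡ-≤ 3 (begin
        3 * n                                                 ≡⟨ triple n ⟩
        n + (n + n)                                           ≤⟨ ℕ.+-mono-≤ (inDense v)
          (ℕ.+-mono-≤ (outDense v) (outDense x)) ⟩
        3 * inDegree v + (3 * outDegree v + 3 * outDegree x)  ≡⟨
          factor (inDegree v) (outDegree v) (outDegree x) ⟩
        3 * (inDegree v + (outDegree v + outDegree x))        ∎)
        where
        triple : ∀ m → 3 * m ≡ m + (m + m)
        triple = solve-∀
        factor : ∀ a b c → 3 * a + (3 * b + 3 * c) ≡ 3 * (a + (b + c))
        factor = solve-∀

    commonOutNeighbour : ∃[ y ] (E v y × E x y)
    commonOutNeighbour with nonempty? (commonOutNeighbours v x)
    ... | yes (y , y∈) with y∈v , y∈x ← x∈p∩q⁻ _ _ y∈ =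
      y , ∈-tabulate⁻ (E? v) y∈v , ∈-tabulate⁻ (E? x) y∈x
    ... | no none = contradiction n<∣reached∣+∣common∣ (ℕ.≤⇒≯ (begin
      ∣ reached v x ∣ + ∣ commonOutNeighbours v x ∣
        ≡⟨ cong (∣ reached v x ∣ ℕ.+_) (Empty⇒∣p∣≡0 _ none) ⟩
      ∣ reached v x ∣ + 0  ≡⟨ ℕ.+-identityʳ _ ⟩
      ∣ reached v x ∣      ≤⟨ ∣p∣≤n (reached v x) ⟩
      n                    ∎))
      where open ≤-Reasoning

    -- The intersection contributes at most 1, so the strict count leaves at least `n` elements for
    -- `reached v x`.
    uniqueCommon⇒reached : ∀ {y} → (∀ {w} → E v w → E x w → w ≡ y) → ∀ w → w ∈ reached v x
    uniqueCommon⇒reached {y} unique w =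
      subst (w ∈_) (sym (∣p∣≡n⇒p≡⊤ (ℕ.≤-antisym (∣p∣≤n (reached v x)) n≤∣reached∣))) ∈⊤
      where
      open ≤-Reasoning
      common⊆ : ∀ {w} → w ∈ commonOutNeighbours v x → w ∈ ⁅ y ⁆
      common⊆ w∈ with w∈v , w∈x ← x∈p∩q⁻ _ _ w∈ =
        subst (_∈ ⁅ y ⁆) (sym (unique (∈-tabulate⁻ (E? v) w∈v) (∈-tabulate⁻ (E? x) w∈x)))
          (x∈⁅x⁆ y)

      n≤∣reached∣ : n ℕ.≤ ∣ reached v x ∣
      n≤∣reached∣ = ℕ.s≤s⁻¹ (begin
        suc n                      ≤⟨ n<∣reached∣+∣common∣ ⟩
        ∣ reached v x ∣ + ∣ commonOutNeighbours v x ∣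
          ≤⟨ ℕ.+-monoʳ-≤ _ (p⊆q⇒∣p∣≤∣q∣ common⊆) ⟩
        ∣ reached v x ∣ + ∣ ⁅ y ⁆ ∣  ≡⟨ cong (∣ reached v x ∣ ℕ.+_) (∣⁅x⁆∣≡1 y) ⟩
        ∣ reached v x ∣ + 1        ≡⟨ ℕ.+-comm _ 1 ⟩
        suc ∣ reached v x ∣        ∎)

-- Walks inside out-neighbourhoods under 7-anti-transitivity.

module _ (D : Digraph n) (H : DenseTriangleFree D) (anti : AntiTransitive D 7) where
  open Digraph D
  open DenseTriangleFree H
  open OutNeighbourhoods H
  open OutNeighbourhoods (reverse-dense H)
    renaming (commonOutNeighbour to commonInNeighbour) using ()

  -- A walk of one, two or three arcs returning to its start would be a loop, a pair of opposite
  -- arcs or a triangle. This and the next two lemmas give all the distinctness in the path of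
  -- length 7 except `x₁ ≢ x₅`.
  arc⇒≢ : ∀ {a b} → E a b → a ≢ b
  arc⇒≢ ab refl = loopless refl ab

  walk₂⇒≢ : ∀ {a b c} → E a b → E b c → a ≢ c
  walk₂⇒≢ ab bc refl = atMostOneArc ab bc

  walk₃⇒≢ : ∀ {a b c d} → E a b → E b c → E c d → a ≢ d
  walk₃⇒≢ {a} {b} {c} ab bc cd refl = triangleFree (a , b , c , ab , bc , cd)

  walk₅-closes : ∀ {v x₁ x₂ x₃ x₄ x₅} →
    E v x₁ → E v x₂ → E v x₃ → E v x₄ → E v x₅ →
    E x₁ x₂ → E x₂ x₃ → E x₃ x₄ → E x₄ x₅ → x₁ ≡ x₅
  walk₅-closes {v} {x₁} {x₂} {x₃} {x₄} {x₅} v1 v2 v3 v4 v5 12' 23' 34' 45'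
    -- The reversed lemma is used twice at `x₅`: `t` comes from the arc `v → x₅`, then `u` from the
    -- arc `t → x₅`.
    with t , t5 , tv ← commonInNeighbour v5
    with u , u5 , ut ← commonInNeighbour t5
    = decidable-stable (x₁ ≟ x₅) λ x₁≢x₅ →
      anti u x₅ (path x₁≢x₅) u5
    where
    vertices : Vec (Fin n) 8
    vertices = u ∷ t ∷ v ∷ x₁ ∷ x₂ ∷ x₃ ∷ x₄ ∷ x₅ ∷ []

    unique : x₁ ≢ x₅ → Unique vertices
    unique x₁≢x₅ =
      (arc⇒≢ ut ∷ walk₂⇒≢ ut tv ∷ u≢ v1 ∷ u≢ v2 ∷ u≢ v3 ∷ u≢ v4 ∷ u≢ v5 ∷ []) ∷
      (arc⇒≢ tv ∷ t≢ v1 ∷ t≢ v2 ∷ t≢ v3 ∷ t≢ v4 ∷ t≢ v5 ∷ []) ∷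
      (arc⇒≢ v1 ∷ arc⇒≢ v2 ∷ arc⇒≢ v3 ∷ arc⇒≢ v4 ∷ arc⇒≢ v5 ∷ []) ∷
      (arc⇒≢ 12' ∷ walk₂⇒≢ 12' 23' ∷ walk₃⇒≢ 12' 23' 34' ∷ x₁≢x₅ ∷ []) ∷
      (arc⇒≢ 23' ∷ walk₂⇒≢ 23' 34' ∷ walk₃⇒≢ 23' 34' 45' ∷ []) ∷
      (arc⇒≢ 34' ∷ walk₂⇒≢ 34' 45' ∷ []) ∷
      (arc⇒≢ 45' ∷ []) ∷
      [] ∷ []
      where
      -- The shortcut through `v` reaches every `xᵢ` in three arcs from `u` and in two from `t`.
      u≢ : ∀ {x} → E v x → u ≢ x
      u≢ = walk₃⇒≢ ut tv
      t≢ : ∀ {x} → E v x → t ≢ x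
      t≢ = walk₂⇒≢ tv

    path : x₁ ≢ x₅ → DirectedPath D 7 u x₅
    path x₁≢x₅ = record
      { vertex   = lookup vertices
      ; distinct = lookup-injective (unique x₁≢x₅) _ _
      ; arc      = λ { 0F → ut ; 1F → tv ; 2F → v1 ; 3F → 12' ; 4F → 23' ; 5F → 34' ; 6F → 45' }
      ; start    = refl
      ; end      = refl
      }

  -- Three further steps inside N⁺(v) make a walk of four arcs, which closes: every arc inside N⁺(v)
  -- lies on a directed 4-cycle there.
  continue₂ : ∀ {v x₁ x₂} → E v x₁ → E v x₂ → E x₁ x₂ →
    ∃[ x₃ ] ∃[ x₄ ] (E v x₃ × E v x₄ × E x₂ x₃ × E x₃ x₄ × E x₄ x₁)
  continue₂ v1 v2 12'
    with x₃ , v3 , 23' ← commonOutNeighbour v2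
    with x₄ , v4 , 34' ← commonOutNeighbour v3
    with x₅ , v5 , 45' ← commonOutNeighbour v4
    with refl ← walk₅-closes v1 v2 v3 v4 v5 12' 23' 34' 45'
    = x₃ , x₄ , v3 , v4 , 23' , 34' , 45'

  -- Going once round the 4-cycle from `y` to `x` and leaving by `x → z` is again a walk of four
  -- arcs inside N⁺(v), so it ends where it began.
  commonOutNeighbour-unique : ∀ {v x y z} → E v x →
    E v y → E x y → E v z → E x z → z ≡ y
  commonOutNeighbour-unique v1 v2 12' vz 1z
    with _ , _ , v3 , v4 , 23' , 34' , 41' ← continue₂ v1 v2 12'
    = sym (walk₅-closes v2 v3 v4 v1 vz 23' 34' 41' 1z)

  noArc : ∀ {v x₁} → ¬ E v x₁
  noArc {v} {x₁} v1
    with x₂ , v2 , 12' ← commonOutNeighbour v1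
    with x₃ , v3 , 23' ← commonOutNeighbour v2
    with c₁ , 1c₁ , 2c₁ ← commonOutNeighbour 12'
    -- `c₃` is an out-neighbour of `x₁` and an in-neighbour of `x₂`; each case below contradicts one
    -- of these arcs or both together.
    with _ , c₃ , _ , 1c₃ , _ , _ , c₃2 ← continue₂ 12' 1c₁ 2c₁
    with x∈p∪q⁻ ⁅ v ⁆ _
           (uniqueCommon⇒reached v2 (commonOutNeighbour-unique v2 v3 23') c₃)
  ... | inj₁ c₃∈v with refl ← x∈⁅y⁆⇒x≡y v c₃∈v = atMostOneArc v1 1c₃
  ... | inj₂ c₃∈ with x∈p∪q⁻ (inNeighbours v) _ c₃∈
  ... | inj₁ c₃∈in = triangleFree (v , x₁ , c₃ , v1 , 1c₃ , ∈-tabulate⁻ (λ u → E? u v) c₃∈in)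
  ... | inj₂ c₃∈out with x∈p∪q⁻ (outNeighbours v) (outNeighbours x₂) c₃∈out
  -- Here `c₃` and `x₂` are both common out-neighbours of `v` and `x₁`, hence equal, and `c₃ → x₂`
  -- is a loop.
  ... | inj₁ c₃∈v = loopless
    (commonOutNeighbour-unique v1 v2 12' (∈-tabulate⁻ (E? v) c₃∈v) 1c₃) c₃2
  ... | inj₂ c₃∈x₂ = atMostOneArc c₃2 (∈-tabulate⁻ (E? x₂) c₃∈x₂)

  inconsistent : Fin n → ⊥
  inconsistent v with nonempty? (outNeighbours v)
  ... | yes (_ , x∈) = noArc (∈-tabulate⁻ (E? v) x∈)
  -- Out-degree 0 would turn the degree bound into `n ≤ 3 * 0`.
  ... | no none = ℕ.<⇒≢ (ℕ.>-nonZero⁻¹ n) (sym (ℕ.n≤0⇒n≡0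
    (subst (λ d → n ℕ.≤ 3 * d) (Empty⇒∣p∣≡0 _ none) (outDense v))))

-- A finite search decides the conclusion, which makes the argument by contradiction constructive.
hasDirectedTriangle? : (D : Digraph n) → Dec (HasDirectedTriangle D)
hasDirectedTriangle? D =
  any? λ x → any? λ y → any? λ z → E? x y ×-dec (E? y z ×-dec E? z x)
  where open Digraph D

open import Data.Integer.Base using (+_)

corollary3p1 : ∀ (n : ℕ) (D : Digraph n) →
    IsOriented D →
    AntiTransitive D 7 →
    (+ n) / 3 ≤ (+ minOutDegree D) / 1 →
    (+ n) / 3 ≤ (+ minInDegree D) / 1 →
    HasDirectedTriangle D
-- The case `0` is ruled out by the field `nonEmpty`; the successor provides the vertex `zero`.
corollary3p1 n@(suc _) D oriented anti minOut minIn =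
  decidable-stable (hasDirectedTriangle? D) λ triangleFree → inconsistent D
    (record
      { oriented     = oriented
      ; triangleFree = triangleFree
      ; outDense     = degree≥ outDegree minOut
      ; inDense      = degree≥ inDegree minIn
      })
    anti zero
  where
  open Digraph D
  degree≥ : ∀ f → (+ n) / 3 ≤ (+ minimum f) / 1 → ∀ v → n ℕ.≤ 3 * f v
  degree≥ f n/3≤ v =
    ℕ.≤-trans (n/3≤d⇒n≤3d n (minimum f) n/3≤) (ℕ.*-monoʳ-≤ 3 (minimum≤ f v))
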